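{- Let $q$ be a prime power and let $n\ge 2$ be an integer. Then \[ s_q(n,2)=(n-1)q^2(q-1)+\binom{n}{2}(q-1)^2. \]
   Context: $\mathbb{F}_q$ is the finite field with $q$ elements. $\mathrm{U}(n,\mathbb{F}_q)$ is the $\mathbb{F}_q$-vector space of $n\times n$ upper triangular matrices over $\mathbb{F}_q$ (entries $m_{i,j}=0$ whenever $i>j$). For $M\in \mathrm{U}(n,\mathbb{F}_q)$ and $1\le i\le n$, $M_{[i]}$ is the $i\times(n-i+1)$ submatrix of $M$ obtained by deleting the first $i-1$ columns and the last $n-i$ rows (i.e. rows $1,\dots,i$ and columns $i,\dots,n$). The flag-rank weight of $M$ is $\mathrm{fr}(M)=\sum_{i=1}^{n}\mathrm{rk}(M_{[i]})$. The number $s_q(n,t)$ is the size of the flag-rank sphere of radius $t$: $s_q(n,t)=|\{A\in \mathrm{U}(n,\mathbb{F}_q):\mathrm{fr}(A)=t\}|$. -}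

module Defs where

open import Level using (Level; _⊔_) renaming (suc to lsuc)
open import Algebra.Bundles using (CommutativeRing)
open import Data.Nat.Base as ℕ using (ℕ; zero; suc; _∸_; _^_; z≤n; s≤s)
open import Data.Nat.Primality using (Prime)
import Data.Nat.Properties as ℕₚ
open import Data.Fin.Base as Fin
  using (Fin; zero; suc; toℕ; inject≤; cast; _↑ʳ_; finToFun; funToFin)
open import Data.Fin.Properties as Finₚ
  using (toℕ<n; toℕ≤n; all?; any?; pigeonhole; finToFun-funToFin)
open import Data.Product.Base using (Σ; ∃; ∃₂; _×_; _,_; proj₁; proj₂)
open import Data.Vec.Functional using (Vector; transpose)
open import Data.Vec.Functional.Relation.Binary.Pointwise using (Pointwise)
open import Function.Base using (_∘_; _on_)
open import Function.Bundles using (Inverse)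
open import Function.Properties.Inverse using (Inverse⇒Injection)
open import Relation.Binary.Bundles using (Setoid)
import Relation.Binary.PropositionalEquality as ≡
open ≡ using (_≡_)
open import Relation.Nullary.Decidable.Core using (Dec; yes; no; map′; _→-dec_)
open import Relation.Nullary.Decidable using (via-injection)
open import Relation.Nullary.Negation.Core using (¬_; contradiction)

private
  variable
    c ℓ : Level
    m n : ℕ

IsPrimePower : ℕ → Set
IsPrimePower q = ∃₂ λ p k → Prime p × 1 ℕ.≤ k × q ≡ p ^ k

HasCardinality : Setoid c ℓ → ℕ → Set (c ⊔ ℓ)
HasCardinality S k = Inverse S (≡.setoid (Fin k))

record FiniteField (c ℓ : Level) (q : ℕ) : Set (lsuc (c ⊔ ℓ)) where
  field
    commutativeRing : CommutativeRing c ℓ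
  open CommutativeRing commutativeRing public
  field
    1≉0         : ¬ (1# ≈ 0#)
    inverse     : ∀ x → ¬ (x ≈ 0#) → ∃ λ y → x * y ≈ 1#
    cardinality : HasCardinality setoid q

module _ {q : ℕ} (F : FiniteField c ℓ q) where
  open FiniteField F
  open import Algebra.Properties.CommutativeMonoid.Sum +-commutativeMonoid
    using (sum; ∑-distrib-+; sum-cong-≋; sum-replicate-zero)
  open import Algebra.Properties.Ring ring using (-‿distribˡ-*)
  open import Relation.Binary.Reasoning.Setoid setoid
  private
    module Card = Inverse cardinality
    module ℕΣ where
      open import Algebra.Properties.Monoid.Sum ℕₚ.+-0-monoid public using (sum)

  Matrix : ℕ → ℕ → Set c
  Matrix m n = Vector (Vector Carrier n) m

  LinearlyIndependent : ∀ {k} → Vector (Vector Carrier m) k → Set (c ⊔ ℓ)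
  LinearlyIndependent {k = k} v =
    (a : Vector Carrier k) →
    (∀ i → sum (λ j → a j * v j i) ≈ 0#) →
    ∀ j → a j ≈ 0#

  -- A linearly independent family is automatically injective, so f may be
  -- read as a choice of r distinct columns of M.
  IndependentColumns : Matrix m n → ℕ → Set (c ⊔ ℓ)
  IndependentColumns {n = n} M r =
    ∃ λ (f : Fin r → Fin n) → LinearlyIndependent (transpose M ∘ f)

  IsRank : Matrix m n → ℕ → Set (c ⊔ ℓ)
  IsRank M r = IndependentColumns M r × (∀ s → IndependentColumns M s → s ℕ.≤ r)

  isRank-unique : ∀ (M : Matrix m n) {r s} → IsRank M r → IsRank M s → r ≡ s
  isRank-unique M (a , b) (a′ , b′) = ℕₚ.≤-antisym (b′ _ a) (b _ a′)

  -- The maximum in IsRank exists: independence is decidable because F is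
  -- finite, and at most n columns can be independent.

  infix 4 _≟_
  _≟_ : ∀ x y → Dec (x ≈ y)
  _≟_ = via-injection (Inverse⇒Injection cardinality) Finₚ._≟_

  private
    dependence : ∀ {k} → Vector (Vector Carrier m) k → Vector Carrier k → Set ℓ
    dependence v a = ∀ i → sum (λ j → a j * v j i) ≈ 0#

    tuple : ∀ {k} → Fin (q ^ k) → Vector Carrier k
    tuple x = Card.from ∘ finToFun x

    code : ∀ {k} → Vector Carrier k → Fin (q ^ k)
    code a = funToFin (Card.to ∘ a)

    tuple-code : ∀ {k} (a : Vector Carrier k) j → tuple (code a) j ≈ a j
    tuple-code a j = begin
      Card.from (finToFun (funToFin (Card.to ∘ a)) j)
        ≡⟨ ≡.cong Card.from (finToFun-funToFin (Card.to ∘ a) j) ⟩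
      Card.from (Card.to (a j))  ≈⟨ Card.inverseʳ ≡.refl ⟩
      a j                        ∎

    independent? : ∀ {k} (v : Vector (Vector Carrier m) k) →
                   Dec (LinearlyIndependent v)
    independent? {m} {k} v = map′ fwd (λ h x → h (tuple x)) dec
      where
      P : Vector Carrier k → Set ℓ
      P a = dependence v a → ∀ j → a j ≈ 0#
      dec : Dec (∀ x → P (tuple x))
      dec = all? λ x → all? (λ i → _ ≟ 0#) →-dec all? (λ j → tuple {k} x j ≟ 0#)
      fwd : (∀ x → P (tuple x)) → LinearlyIndependent v
      fwd h a dep j = trans (sym (tuple-code a j)) (h (code a) dep′ j)
        where
        dep′ : dependence v (tuple (code a))
        dep′ i = trans (sum-cong-≋ λ j → *-congʳ (tuple-code a j)) (dep i)

    independentColumns? : (M : Matrix m n) → ∀ r → Dec (IndependentColumns M r)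
    independentColumns? {m} {n} M r = map′
      (λ (x , h) → finToFun x , h)
      (λ (f , h) → funToFin f , λ a dep → h a λ i → trans
        (sum-cong-≋ λ j → *-congˡ (reflexive
          (≡.cong (M i) (≡.sym (finToFun-funToFin f j)))))
        (dep i))
      (any? λ x → independent? (transpose M ∘ finToFun x))

    e : ∀ {k} → Fin k → Vector Carrier k
    e zero    zero    = 1#
    e zero    (suc _) = 0#
    e (suc _) zero    = 0#
    e (suc x) (suc y) = e x y

    e-diag : ∀ {k} (x : Fin k) → e x x ≡ 1#
    e-diag zero    = ≡.refl
    e-diag (suc x) = e-diag x

    e-off : ∀ {k} (x y : Fin k) → ¬ (x ≡ y) → e x y ≡ 0#
    e-off zero    zero    x≢y = contradiction ≡.refl x≢y
    e-off zero    (suc _) x≢y = ≡.refl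
    e-off (suc _) zero    x≢y = ≡.refl
    e-off (suc x) (suc y) x≢y = e-off x y (x≢y ∘ ≡.cong suc)

    sum-e : ∀ {k} (x : Fin k) (w : Vector Carrier k) →
            sum (λ j → e x j * w j) ≈ w x
    sum-e {suc k} zero    w = trans
      (+-cong (*-identityˡ _)
              (trans (sum-cong-≋ {k} λ j → zeroˡ (w (suc j)))
                     (sum-replicate-zero k)))
      (+-identityʳ _)
    sum-e         (suc x) w = trans
      (+-cong (zeroˡ _) (sum-e x (w ∘ suc))) (+-identityˡ _)

    bounded : (M : Matrix m n) → ∀ r → IndependentColumns M r → r ℕ.≤ n
    bounded {n = n} M r (f , indep) with r ℕₚ.≤? n
    ... | yes r≤n = r≤n
    ... | no  r≰n = contradiction (trans (sym ax≈1) (indep a dep x)) 1≉0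
      where
      coll : ∃₂ λ x y → x Fin.< y × f x ≡ f y
      coll = pigeonhole (ℕₚ.≰⇒> r≰n) f
      x y : Fin r
      x = proj₁ coll
      y = proj₁ (proj₂ coll)
      x≢y : ¬ (x ≡ y)
      x≢y = Finₚ.<⇒≢ (proj₁ (proj₂ (proj₂ coll)))
      fx≡fy : f x ≡ f y
      fx≡fy = proj₂ (proj₂ (proj₂ coll))
      a : Vector Carrier r
      a j = e x j + - 1# * e y j
      ax≈1 : a x ≈ 1#
      ax≈1 = begin
        e x x + - 1# * e y x  ≡⟨ ≡.cong₂ (λ s t → s + - 1# * t) (e-diag x)
                                   (e-off y x (x≢y ∘ ≡.sym)) ⟩
        1# + - 1# * 0#        ≈⟨ +-congˡ (zeroʳ _) ⟩
        1# + 0#               ≈⟨ +-identityʳ _ ⟩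
        1#                    ∎
      dep : ∀ i → sum (λ j → a j * M i (f j)) ≈ 0#
      dep i = begin
        sum (λ j → a j * M i (f j))
          ≈⟨ sum-cong-≋ {r} (λ j → trans
               (distribʳ (M i (f j)) (e x j) (- 1# * e y j))
               (+-congˡ (trans (*-congʳ (*-comm (- 1#) (e y j)))
                               (*-assoc (e y j) (- 1#) (M i (f j)))))) ⟩
        sum (λ j → e x j * M i (f j) + e y j * (- 1# * M i (f j)))
          ≈⟨ ∑-distrib-+ (λ j → e x j * M i (f j)) _ ⟩
        sum (λ j → e x j * M i (f j)) + sum (λ j → e y j * (- 1# * M i (f j)))
          ≈⟨ +-cong (sum-e x _) (sum-e y _) ⟩
        M i (f x) + - 1# * M i (f y)
          ≈⟨ +-congˡ (trans (sym (-‿distribˡ-* _ _)) (-‿cong (*-identityˡ _))) ⟩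
        M i (f x) + - M i (f y)
          ≡⟨ ≡.cong (λ z → M i z + - M i (f y)) fx≡fy ⟩
        M i (f y) + - M i (f y)  ≈⟨ -‿inverseʳ _ ⟩
        0#                       ∎

    rank-below : (M : Matrix m n) → ∀ b →
                 (∀ s → IndependentColumns M s → s ℕ.≤ b) → ∃ (IsRank M)
    rank-below M zero    ub = 0 , ((λ ()) , λ _ _ ()) , ub
    rank-below M (suc b) ub with independentColumns? M (suc b)
    ... | yes h = suc b , h , ub
    ... | no ¬h = rank-below M b λ s h → ℕₚ.<⇒≤pred
          (ℕₚ.≤∧≢⇒< (ub s h) λ { ≡.refl → ¬h h })

  rank-exists : (M : Matrix m n) → ∃ (IsRank M)
  rank-exists {n = n} M = rank-below M n (bounded M)

  rank : Matrix m n → ℕ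
  rank M = proj₁ (rank-exists M)

  rank-isRank : (M : Matrix m n) → IsRank M (rank M)
  rank-isRank M = proj₂ (rank-exists M)

  UpperTriangular : Matrix n n → Set ℓ
  UpperTriangular M = ∀ i j → j Fin.< i → M i j ≈ 0#

  U : ℕ → Set (c ⊔ ℓ)
  U n = Σ (Matrix n n) UpperTriangular

  -- Indices in Fin n start at 0, so i stands for the 1-based index
  -- suc (toℕ i): the block has 1-based rows 1, …, suc (toℕ i) and columns
  -- suc (toℕ i), …, n.
  block : Matrix n n → (i : Fin n) → Matrix (suc (toℕ i)) (n ∸ toℕ i)
  block M i r s =
    M (inject≤ r (toℕ<n i))
      (cast (ℕₚ.m+[n∸m]≡n (toℕ≤n i)) (toℕ i ↑ʳ s))

  flagRank : U n → ℕ
  flagRank (M , _) = ℕΣ.sum (λ i → rank (block M i))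

  -- Elements are compared entrywise as matrices, ignoring the proof
  -- components.
  flagRankSphere : ℕ → ℕ → Setoid (c ⊔ ℓ) ℓ
  flagRankSphere n t = record
    { Carrier = Σ (U n) λ A → flagRank A ≡ t
    ; _≈_     = Pointwise (Pointwise _≈_) on (proj₁ ∘ proj₁)
    ; isEquivalence = record
      { refl  = λ i j → refl
      ; sym   = λ p i j → sym (p i j)
      ; trans = λ p r i j → trans (p i j) (r i j)
      }
    }

{-# OPTIONS --safe #-}

-- A nonzero entry at (r , s) makes every block k with r ≤ k ≤ s nonzero, and
-- if a single block is nonzero then it has one nonzero entry, hence rank 1.
-- So flag-rank 2 means exactly two nonzero blocks i < j, both of rank 1, and
-- the nonzero entries lie at (i , i), (i , j) and (j , j).  Either the entry at
-- (i , j) is nonzero, which forces j = i + 1 and leaves the two diagonal entries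
-- arbitrary, or it vanishes and both diagonal entries are nonzero.

module Submission where

open import Defs
open import Level using (Level)
open import Data.Nat.Base as ℕ using (ℕ; zero; suc; pred; _∸_; _^_; z≤n; s≤s)
open import Data.Nat.Combinatorics using (_C_; nC1≡n; nCk+nC[k+1]≡[n+1]C[k+1])
import Data.Nat.Properties as ℕₚ
open import Algebra.Properties.Monoid.Sum ℕₚ.+-0-monoid
  using () renaming (sum to sumℕ)
open import Data.Fin.Base as Fin
  using (Fin; zero; suc; toℕ; inject₁; inject≤; fromℕ<; cast; _↑ʳ_;
         punchIn; punchOut)
open import Data.Fin.Properties as Finₚ using (any?; *↔×; +↔⊎)
open import Data.Product.Base using (∃; ∃₂; _×_; _,_; proj₁; proj₂)
open import Data.Product.Function.NonDependent.Propositional using (_×-↔_)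
open import Data.Sum.Base using (_⊎_; inj₁; inj₂)
open import Data.Sum.Function.Propositional using (_⊎-↔_)
open import Data.Vec.Functional using (Vector; transpose; updateAt)
open import Data.Vec.Functional.Properties using (updateAt-updates; updateAt-minimal)
open import Function.Base using (_∘_; const)
open import Function.Bundles using (Inverse; _↔_; mk↔ₛ′)
open import Function.Construct.Composition using (_↔-∘_) renaming (inverse to inverse-∘)
open import Function.Properties.Inverse using (↔-refl; ↔-sym)
open import Relation.Binary.Bundles using (Setoid)
open import Relation.Binary.Definitions using (tri<; tri≈; tri>)
import Relation.Binary.PropositionalEquality as ≡
open ≡ using (_≡_; _≢_)
open import Relation.Nullary.Decidable using
  (Dec; yes; no; ¬?; _×-dec_; _⊎-dec_; decidable-stable)
open import Relation.Nullary.Negation using (¬_; contradiction)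

private
  variable
    c ℓ : Level
    m n : ℕ

-- Sums of natural numbers equal to 2

sum-pred : (f : Vector ℕ n) (i : Fin n) → f i ≢ 0 →
           sumℕ f ≡ suc (sumℕ (updateAt f i pred))
sum-pred {suc n} f zero fi≢0 with f zero
... | zero  = contradiction ≡.refl fi≢0
... | suc _ = ≡.refl
sum-pred {suc n} f (suc i) fi≢0 = ≡.trans
  (≡.cong (f zero ℕ.+_) (sum-pred (f ∘ suc) i fi≢0)) (ℕₚ.+-suc (f zero) _)

sum-zero : (f : Vector ℕ n) → (∀ i → f i ≡ 0) → sumℕ f ≡ 0
sum-zero {zero}  f f≡0 = ≡.refl
sum-zero {suc n} f f≡0 = ≡.cong₂ ℕ._+_ (f≡0 zero) (sum-zero (f ∘ suc) (f≡0 ∘ suc))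

sum-zero⁻¹ : (f : Vector ℕ n) → sumℕ f ≡ 0 → ∀ i → f i ≡ 0
sum-zero⁻¹ f s zero    = ℕₚ.m+n≡0⇒m≡0 (f zero) s
sum-zero⁻¹ f s (suc i) = sum-zero⁻¹ (f ∘ suc) (ℕₚ.m+n≡0⇒n≡0 (f zero) s) i

sum-nonzero : (f : Vector ℕ n) → sumℕ f ≢ 0 → ∃ λ i → f i ≢ 0
sum-nonzero f s≢0 with any? (λ i → ¬? (f i ℕₚ.≟ 0))
... | yes p = p
... | no ¬p = contradiction
  (sum-zero f λ i → decidable-stable (f i ℕₚ.≟ 0) λ h → ¬p (i , h)) s≢0

module _ (f : Vector ℕ n) {i j : Fin n} (i≢j : i ≢ j) where

  private
    f′ f″ : Vector ℕ n
    f′ = updateAt f i pred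
    f″ = updateAt f′ j pred

    f′j≡fj : f′ j ≡ f j
    f′j≡fj = updateAt-minimal j i f (i≢j ∘ ≡.sym)

    sum-pred₂ : f i ≢ 0 → f j ≢ 0 → sumℕ f ≡ suc (suc (sumℕ f″))
    sum-pred₂ fi fj = ≡.trans (sum-pred f i fi)
      (≡.cong suc (sum-pred f′ j (fj ∘ ≡.trans (≡.sym f′j≡fj))))

    f″-other : ∀ {k} → k ≢ i → k ≢ j → f″ k ≡ f k
    f″-other {k} k≢i k≢j =
      ≡.trans (updateAt-minimal k j f′ k≢j) (updateAt-minimal k i f k≢i)

  -- Taking one unit off at `i` and one at `j` uses up the whole sum, and the entries elsewhere are
  -- not touched by this.
  sum≡2⇒others≡0 : f i ≢ 0 → f j ≢ 0 → sumℕ f ≡ 2 →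
                   ∀ k → k ≢ i → k ≢ j → f k ≡ 0
  sum≡2⇒others≡0 fi fj s k k≢i k≢j = ≡.trans (≡.sym (f″-other k≢i k≢j))
    (sum-zero⁻¹ f″ (ℕₚ.suc-injective (ℕₚ.suc-injective
      (≡.trans (≡.sym (sum-pred₂ fi fj)) s))) k)

  two-ones⇒sum≡2 : f i ≡ 1 → f j ≡ 1 →
                   (∀ k → k ≢ i → k ≢ j → f k ≡ 0) → sumℕ f ≡ 2
  two-ones⇒sum≡2 fi fj others = ≡.trans
    (sum-pred₂ (≢0 fi) (≢0 fj)) (≡.cong (2 ℕ.+_) (sum-zero f″ f″≡0))
    where
    ≢0 : ∀ {x} → x ≡ 1 → x ≢ 0
    ≢0 ≡.refl ()
    f″≡0 : ∀ k → f″ k ≡ 0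
    f″≡0 k with k Finₚ.≟ j
    ... | yes ≡.refl = ≡.trans (updateAt-updates j f′)
                         (≡.cong pred (≡.trans f′j≡fj fj))
    ... | no k≢j with k Finₚ.≟ i
    ...   | yes ≡.refl = ≡.trans (updateAt-minimal i j f′ k≢j)
                           (≡.trans (updateAt-updates i f) (≡.cong pred fi))
    ...   | no k≢i = ≡.trans (f″-other k≢i k≢j) (others k k≢i k≢j)

-- The bound by 1 forces the two units to sit at different indices.
sum≡2⇒two-nonzero : (f : Vector ℕ n) → (∀ i → f i ℕ.≤ 1) → sumℕ f ≡ 2 →
                    ∃₂ λ i j → i Fin.< j × f i ≢ 0 × f j ≢ 0
sum≡2⇒two-nonzero {n} f f≤1 s = order (Finₚ.<-cmp i j)
  where
  first = sum-nonzero f λ s≡0 → contradiction (≡.trans (≡.sym s) s≡0) λ ()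
  i = proj₁ first
  f′ = updateAt f i pred
  second = sum-nonzero f′ λ s≡0 → contradiction
    (≡.trans (≡.sym s) (≡.trans (sum-pred f i (proj₂ first)) (≡.cong suc s≡0))) λ ()
  j = proj₁ second
  i≢j : i ≢ j
  -- By the bound, `f′` vanishes at `i`, so its nonzero entry lies elsewhere.
  i≢j i≡j = proj₂ second (≡.trans (≡.cong f′ (≡.sym i≡j))
    (≡.trans (updateAt-updates i f) (ℕₚ.n≤0⇒n≡0 (ℕₚ.pred-mono-≤ (f≤1 i)))))
  fj≢0 : f j ≢ 0
  fj≢0 = proj₂ second ∘ ≡.trans (updateAt-minimal j i f (i≢j ∘ ≡.sym))
  order : _ → ∃₂ λ i j → i Fin.< j × f i ≢ 0 × f j ≢ 0
  order (tri< i<j _ _) = i , j , i<j , proj₂ first , fj≢0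
  order (tri≈ _ i≡j _) = contradiction i≡j i≢j
  order (tri> _ _ j<i) = j , i , j<i , fj≢0 , proj₂ first

-- Counting pairs of indices

-- Two-element subsets of Fin n, presented along Pascal's rule.
data Pair : ℕ → Set where
  first : Fin n → Pair (suc n)
  later : Pair n → Pair (suc n)

lo hi : Pair n → Fin n
lo (first j) = zero
lo (later p) = suc (lo p)
hi (first j) = suc j
hi (later p) = suc (hi p)

lo<hi : (p : Pair n) → lo p Fin.< hi p
lo<hi (first j) = s≤s z≤n
lo<hi (later p) = s≤s (lo<hi p)

pair : (i j : Fin n) → i Fin.< j → ∃ λ (p : Pair n) → lo p ≡ i × hi p ≡ j
pair zero    (suc j) _ = first j , ≡.refl , ≡.refl
pair (suc i) (suc j) (s≤s i<j) with pair i j i<j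
... | p , ≡.refl , ≡.refl = later p , ≡.refl , ≡.refl

pair-injective : (p p′ : Pair n) → lo p ≡ lo p′ → hi p ≡ hi p′ → p ≡ p′
pair-injective (first j) (first j′) _ eq = ≡.cong first (Finₚ.suc-injective eq)
pair-injective (later p) (later p′) eq eq′ = ≡.cong later
  (pair-injective p p′ (Finₚ.suc-injective eq) (Finₚ.suc-injective eq′))

-- There are `n C 1` pairs whose smaller element is 0, and the rest are pairs among the `n`
-- remaining indices, so the induction follows Pascal's rule.
Pair↔Fin : ∀ n → Pair n ↔ Fin (n C 2)
Pair↔Fin zero    = mk↔ₛ′ (λ ()) (λ ()) (λ ()) (λ ())
Pair↔Fin (suc n) = ≡.subst (λ k → Pair (suc n) ↔ Fin k) pascal
  (↔-sym +↔⊎ ↔-∘ ((↔-refl ⊎-↔ Pair↔Fin n) ↔-∘ split))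
  where
  split : Pair (suc n) ↔ (Fin n ⊎ Pair n)
  split = mk↔ₛ′ (λ { (first j) → inj₁ j ; (later p) → inj₂ p })
                (λ { (inj₁ j) → first j ; (inj₂ p) → later p })
                (λ { (inj₁ j) → ≡.refl ; (inj₂ p) → ≡.refl })
                (λ { (first j) → ≡.refl ; (later p) → ≡.refl })
  pascal : n ℕ.+ n C 2 ≡ suc n C 2
  pascal = ≡.trans (≡.cong (ℕ._+ n C 2) (≡.sym (nC1≡n n)))
                   (nCk+nC[k+1]≡[n+1]C[k+1] n 1)

-- For i < j these are the positions with both indices in {i, j} that lie on or above the diagonal.
Corner : (i j r s : Fin n) → Set
Corner i j r s = (r ≡ i × s ≡ i) ⊎ (r ≡ i × s ≡ j) ⊎ (r ≡ j × s ≡ j)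

corner? : (i j r s : Fin n) → Dec (Corner i j r s)
corner? i j r s =
  (r Finₚ.≟ i ×-dec s Finₚ.≟ i) ⊎-dec
  (r Finₚ.≟ i ×-dec s Finₚ.≟ j) ⊎-dec
  (r Finₚ.≟ j ×-dec s Finₚ.≟ j)

Corner⇒≤ : ∀ {i j r s : Fin n} → i Fin.< j → Corner i j r s → r Fin.≤ s
Corner⇒≤ _   (inj₁ (≡.refl , ≡.refl))        = ℕₚ.≤-refl
Corner⇒≤ i<j (inj₂ (inj₁ (≡.refl , ≡.refl))) = ℕₚ.<⇒≤ i<j
Corner⇒≤ _   (inj₂ (inj₂ (≡.refl , ≡.refl))) = ℕₚ.≤-refl

-- Matrices of rank 0 and of rank at most 1

module _ {q : ℕ} (F : FiniteField c ℓ q) where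
  open FiniteField F hiding (zero)
  open import Algebra.Properties.CommutativeMonoid.Sum +-commutativeMonoid
    using (sum; sum-cong-≋; sum-replicate-zero)
  open import Algebra.Properties.Ring ring using (-‿distribˡ-*)
  open import Relation.Binary.Reasoning.Setoid setoid

  x*y≈0⇒x≈0 : ∀ {x y} → ¬ y ≈ 0# → x * y ≈ 0# → x ≈ 0#
  x*y≈0⇒x≈0 {x} {y} y≉0 xy≈0 = let (z , yz≈1) = inverse y y≉0 in begin
    x            ≈⟨ *-identityʳ x ⟨
    x * 1#       ≈⟨ *-congˡ yz≈1 ⟨
    x * (y * z)  ≈⟨ *-assoc x y z ⟨
    x * y * z    ≈⟨ *-congʳ xy≈0 ⟩
    0# * z       ≈⟨ zeroˡ z ⟩
    0#           ∎

  -- Supports are described below through nonzero entries; decidable equality turns such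
  -- descriptions into vanishing everywhere else.
  ≈0-stable : ∀ {x} → ¬ ¬ x ≈ 0# → x ≈ 0#
  ≈0-stable {x} = decidable-stable (_≟_ F x 0#)

  private
    sum-0* : ∀ {k} (w : Vector Carrier k) → sum (λ j → 0# * w j) ≈ 0#
    sum-0* {k} w = trans (sum-cong-≋ (zeroˡ ∘ w)) (sum-replicate-zero k)

  independent⇒head≉0 : ∀ {k} {v : Vector (Vector Carrier m) (suc k)} →
    LinearlyIndependent F v → ¬ (∀ i → v zero i ≈ 0#)
  independent⇒head≉0 {m} {k} {v} indep v₀≈0 = 1≉0 (indep a dep zero)
    where
    a : Vector Carrier (suc k)
    a zero    = 1#
    a (suc _) = 0#
    dep : ∀ i → sum (λ j → a j * v j i) ≈ 0#
    dep i = trans (+-cong (trans (*-congˡ (v₀≈0 i)) (zeroʳ 1#)) (sum-0* {k} λ j → v (suc j) i))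
                  (+-identityˡ 0#)

  -- A relation between the first two vectors extends to the whole family by zero coefficients.
  independent⇒pair : ∀ {k} {v : Vector (Vector Carrier m) (suc (suc k))} →
    LinearlyIndependent F v → ∀ α β →
    (∀ i → α * v zero i + β * v (suc zero) i ≈ 0#) → α ≈ 0# × β ≈ 0#
  independent⇒pair {m} {k} {v} indep α β rel =
    indep a dep zero , indep a dep (suc zero)
    where
    a : Vector Carrier (suc (suc k))
    a zero          = α
    a (suc zero)    = β
    a (suc (suc _)) = 0#
    dep : ∀ i → sum (λ j → a j * v j i) ≈ 0#
    dep i = trans (+-congˡ (trans
      (+-congˡ (sum-0* {k} λ j → v (suc (suc j)) i)) (+-identityʳ _))) (rel i)

  rank-zero : (M : Matrix F m n) → (∀ r s → M r s ≈ 0#) → rank F M ≡ 0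
  rank-zero M M≈0 with rank F M | rank-isRank F M
  ... | zero  | _               = ≡.refl
  ... | suc k | (f , indep) , _ = contradiction
    (λ i → M≈0 i (f zero)) (independent⇒head≉0 {v = transpose M ∘ f} indep)

  -- A nonzero entry makes its column an independent family of length 1.
  rank-zero⁻¹ : (M : Matrix F m n) → rank F M ≡ 0 → ∀ r s → M r s ≈ 0#
  rank-zero⁻¹ M ρ≡0 r s = ≈0-stable λ Mrs≉0 → contradiction
    (≡.subst (1 ℕ.≤_) ρ≡0 (proj₂ (rank-isRank F M) 1
      (const s , λ { a dep zero →
        x*y≈0⇒x≈0 Mrs≉0 (trans (sym (+-identityʳ _)) (dep r)) })))
    λ ()

  -- The hypothesis is the vanishing of all 2 by 2 minors. Given two independent columns, fix a row
  -- `r`: the minors through it form a linear relation between the columns, with the entries of row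
  -- `r` as coefficients up to sign. These must vanish for every `r`, so one column is zero.
  rank≤1 : (M : Matrix F m n) →
           (∀ r r′ s s′ → M r s * M r′ s′ ≈ M r s′ * M r′ s) → rank F M ℕ.≤ 1
  rank≤1 M minors with rank F M | rank-isRank F M
  ... | zero        | _ = z≤n
  ... | suc zero    | _ = s≤s z≤n
  ... | suc (suc k) | (f , indep) , _ = contradiction
        -- Column `s′` is zero, so the coefficients 0 and 1 give a nontrivial relation.
        (proj₂ (dependent⇒0 0# 1# λ r → trans
          (+-cong (zeroˡ _) (trans (*-identityˡ _) (column≈0 r))) (+-identityˡ 0#)))
        1≉0
    where
    dependent⇒0 = independent⇒pair {v = transpose M ∘ f} indep
    s  = f zero
    s′ = f (suc zero)
    column≈0 : ∀ r → M r s′ ≈ 0#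
    column≈0 r = proj₁ (dependent⇒0 (M r s′) (- M r s) λ r′ → begin
      M r s′ * M r′ s + - M r s * M r′ s′
        ≈⟨ +-cong (sym (minors r r′ s s′)) (sym (-‿distribˡ-* _ _)) ⟩
      M r s * M r′ s′ + - (M r s * M r′ s′)  ≈⟨ -‿inverseʳ _ ⟩
      0#                                     ∎)

  -- Ranks of the blocks

  module _ (M : Matrix F n n) (i : Fin n) where

    blockRank : ℕ
    blockRank = rank F (block F M i)

    private
      row : Fin (suc (toℕ i)) → Fin n
      row r = inject≤ r (Finₚ.toℕ<n i)

      col : Fin (n ∸ toℕ i) → Fin n
      col s = cast (ℕₚ.m+[n∸m]≡n (Finₚ.toℕ≤n i)) (toℕ i ↑ʳ s)

      toℕ-col : ∀ s → toℕ (col s) ≡ toℕ i ℕ.+ toℕ s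
      toℕ-col s = ≡.trans (Finₚ.toℕ-cast _ (toℕ i ↑ʳ s)) (Finₚ.toℕ-↑ʳ (toℕ i) s)

      row≤ : ∀ r → row r Fin.≤ i
      row≤ r = ≡.subst (ℕ._≤ toℕ i) (≡.sym (Finₚ.toℕ-inject≤ r (Finₚ.toℕ<n i)))
        (ℕ.s≤s⁻¹ (Finₚ.toℕ<n r))

      ≤col : ∀ s → i Fin.≤ col s
      ≤col s = ≡.subst (toℕ i ℕ.≤_) (≡.sym (toℕ-col s)) (ℕₚ.m≤m+n _ _)

    -- Together with its converse, this replaces block coordinates by positions in `M`: block `i`
    -- consists of the positions with r ≤ i ≤ s.
    blockRank-zero : (∀ r s → r Fin.≤ i → i Fin.≤ s → M r s ≈ 0#) → blockRank ≡ 0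
    blockRank-zero M≈0 = rank-zero (block F M i) λ r s → M≈0 _ _ (row≤ r) (≤col s)

    blockRank-zero⁻¹ : blockRank ≡ 0 → ∀ r s → r Fin.≤ i → i Fin.≤ s → M r s ≈ 0#
    blockRank-zero⁻¹ ρ≡0 r s r≤i i≤s = ≡.subst₂ (λ r s → M r s ≈ 0#)
      (Finₚ.toℕ-injective (≡.trans (Finₚ.toℕ-inject≤ r′ (Finₚ.toℕ<n i))
        (Finₚ.toℕ-fromℕ< (s≤s r≤i))))
      (Finₚ.toℕ-injective (≡.trans (toℕ-col s′)
        (≡.trans (≡.cong (toℕ i ℕ.+_) (Finₚ.toℕ-fromℕ< s∸i<n∸i))
                 (ℕₚ.m+[n∸m]≡n i≤s))))
      (rank-zero⁻¹ (block F M i) ρ≡0 r′ s′)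
      where
      s∸i<n∸i : toℕ s ∸ toℕ i ℕ.< n ∸ toℕ i
      s∸i<n∸i = ℕₚ.∸-monoˡ-< (Finₚ.toℕ<n s) i≤s
      -- Block coordinates of (r, s): rows keep their index, columns are shifted down by `i`.
      r′ = fromℕ< (s≤s r≤i)
      s′ = fromℕ< s∸i<n∸i

    blockRank-nonzero : ∀ {r s} → r Fin.≤ i → i Fin.≤ s → ¬ M r s ≈ 0# → blockRank ≢ 0
    blockRank-nonzero r≤i i≤s M≉0 ρ≡0 = M≉0 (blockRank-zero⁻¹ ρ≡0 _ _ r≤i i≤s)

    private
      0*0 : ∀ {w x y z} → w ≈ 0# → y ≈ 0# → w * x ≈ y * z
      0*0 w≈0 y≈0 = trans (trans (*-congʳ w≈0) (zeroˡ _))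
                          (sym (trans (*-congʳ y≈0) (zeroˡ _)))

    -- In a 2 by 2 minor, a row other than `r₀` puts a zero factor into both products; if both rows
    -- are `r₀`, the products agree by commutativity.
    single-row⇒blockRank≤1 : ∀ r₀ →
      (∀ r s → r Fin.≤ i → i Fin.≤ s → r ≢ r₀ → M r s ≈ 0#) → blockRank ℕ.≤ 1
    single-row⇒blockRank≤1 r₀ M≈0 = rank≤1 (block F M i) λ r r′ s s′ →
      minor (row≤ r) (row≤ r′) (≤col s) (≤col s′)
      where
      minor : ∀ {r r′ s s′} → r Fin.≤ i → r′ Fin.≤ i → i Fin.≤ s → i Fin.≤ s′ →
              M r s * M r′ s′ ≈ M r s′ * M r′ s
      minor {r} {r′} {s} {s′} r≤ r′≤ ≤s ≤s′ with r Finₚ.≟ r₀ | r′ Finₚ.≟ r₀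
      ... | no r≢ | _ = 0*0 (M≈0 r s r≤ ≤s r≢) (M≈0 r s′ r≤ ≤s′ r≢)
      ... | yes _ | no r′≢ = trans (*-comm _ _) (trans
            (0*0 (M≈0 r′ s′ r′≤ ≤s′ r′≢) (M≈0 r′ s r′≤ ≤s r′≢)) (*-comm _ _))
      ... | yes ≡.refl | yes ≡.refl = *-comm _ _

    single-column⇒blockRank≤1 : ∀ s₀ →
      (∀ r s → r Fin.≤ i → i Fin.≤ s → s ≢ s₀ → M r s ≈ 0#) → blockRank ℕ.≤ 1
    single-column⇒blockRank≤1 s₀ M≈0 = rank≤1 (block F M i) λ r r′ s s′ →
      minor (row≤ r) (row≤ r′) (≤col s) (≤col s′)
      where
      minor : ∀ {r r′ s s′} → r Fin.≤ i → r′ Fin.≤ i → i Fin.≤ s → i Fin.≤ s′ →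
              M r s * M r′ s′ ≈ M r s′ * M r′ s
      minor {r} {r′} {s} {s′} r≤ r′≤ ≤s ≤s′ with s Finₚ.≟ s₀ | s′ Finₚ.≟ s₀
      ... | no s≢ | _ = trans
            (0*0 (M≈0 r s r≤ ≤s s≢) (M≈0 r′ s r′≤ ≤s s≢)) (*-comm _ _)
      ... | yes _ | no s′≢ = trans (*-comm _ _)
            (0*0 (M≈0 r′ s′ r′≤ ≤s′ s′≢) (M≈0 r s′ r≤ ≤s′ s′≢))
      ... | yes ≡.refl | yes ≡.refl = refl

  -- This unfolds to the same sum as `flagRank`, but on the bare matrix, so no proof of
  -- triangularity has to be carried along.
  flagRankℕ : Matrix F n n → ℕ
  flagRankℕ M = sumℕ (blockRank M)

  -- Matrices supported on a corner

  -- Meant for i ≢ j; otherwise only d survives.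
  corner : (i j : Fin n) (a b d : Carrier) → Matrix F n n
  corner i j a b d = updateAt (updateAt (λ _ _ → 0#) i (const rowᵢ)) j (const rowⱼ)
    where
    rowᵢ = updateAt (updateAt (λ _ → 0#) i (const a)) j (const b)
    rowⱼ = updateAt (λ _ → 0#) j (const d)

  module _ {i j : Fin n} (i≢j : i ≢ j) (a b d : Carrier) where
    private
      K = corner i j a b d
      0ᵣ : Vector Carrier n
      0ᵣ _ = 0#
      0ₘ : Matrix F n n
      0ₘ _ = 0ᵣ
      rowᵢ = updateAt (updateAt 0ᵣ i (const a)) j (const b)
      rowⱼ = updateAt 0ᵣ j (const d)

      Kᵢ : K i ≡ rowᵢ
      Kᵢ = ≡.trans (updateAt-minimal i j (updateAt 0ₘ i (const rowᵢ)) i≢j)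
                   (updateAt-updates i 0ₘ)

      Kⱼ : K j ≡ rowⱼ
      Kⱼ = updateAt-updates j (updateAt 0ₘ i (const rowᵢ))

    corner-ii : K i i ≡ a
    corner-ii = ≡.trans (≡.cong-app Kᵢ i) (≡.trans
      (updateAt-minimal i j (updateAt 0ᵣ i (const a)) i≢j) (updateAt-updates i 0ᵣ))

    corner-ij : K i j ≡ b
    corner-ij = ≡.trans (≡.cong-app Kᵢ j)
      (updateAt-updates j (updateAt 0ᵣ i (const a)))

    corner-jj : K j j ≡ d
    corner-jj = ≡.trans (≡.cong-app Kⱼ j) (updateAt-updates j 0ᵣ)

    corner-ji : K j i ≡ 0#
    corner-ji = ≡.trans (≡.cong-app Kⱼ i) (updateAt-minimal i j 0ᵣ i≢j)

    corner-row : ∀ r s → r ≢ i → r ≢ j → K r s ≡ 0#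
    corner-row r s r≢i r≢j = ≡.cong-app (≡.trans
      (updateAt-minimal r j (updateAt 0ₘ i (const rowᵢ)) r≢j)
      (updateAt-minimal r i 0ₘ r≢i)) s

    corner-column : ∀ r s → s ≢ i → s ≢ j → K r s ≡ 0#
    corner-column r s s≢i s≢j with r Finₚ.≟ i | r Finₚ.≟ j
    ... | yes ≡.refl | _ = ≡.trans (≡.cong-app Kᵢ s) (≡.trans
          (updateAt-minimal s j (updateAt 0ᵣ i (const a)) s≢j)
          (updateAt-minimal s i 0ᵣ s≢i))
    ... | no _    | yes ≡.refl = ≡.trans (≡.cong-app Kⱼ s) (updateAt-minimal s j 0ᵣ s≢j)
    ... | no r≢i | no r≢j = corner-row r s r≢i r≢j

  CornerSupported : Matrix F n n → (i j : Fin n) → Set ℓ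
  CornerSupported M i j = ∀ r s → ¬ M r s ≈ 0# → Corner i j r s

  corner-supported : ∀ {i j : Fin n} → i ≢ j → ∀ a b d →
                     CornerSupported (corner i j a b d) i j
  corner-supported {i = i} {j} i≢j a b d r s K≉0
    with r Finₚ.≟ i | r Finₚ.≟ j | s Finₚ.≟ i | s Finₚ.≟ j
  ... | no r≢i  | no r≢j  | _       | _       =
        contradiction (reflexive (corner-row i≢j a b d r s r≢i r≢j)) K≉0
  ... | _       | _       | no s≢i  | no s≢j  =
        contradiction (reflexive (corner-column i≢j a b d r s s≢i s≢j)) K≉0
  ... | yes r≡i | _       | yes s≡i | _       = inj₁ (r≡i , s≡i)
  ... | yes r≡i | _       | _       | yes s≡j = inj₂ (inj₁ (r≡i , s≡j))
  ... | _       | yes r≡j | _       | yes s≡j = inj₂ (inj₂ (r≡j , s≡j))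
  -- Position (j, i) is the only one with both indices in {i, j} outside the corner.
  ... | no _    | yes ≡.refl | yes ≡.refl | no _ =
        contradiction (reflexive (corner-ji i≢j a b d)) K≉0

  -- Both matrices vanish off the corner, so agreement at its three positions is enough.
  corner≈ : ∀ (M : Matrix F n n) {i j a b d} → i ≢ j → CornerSupported M i j →
            a ≈ M i i → b ≈ M i j → d ≈ M j j →
            ∀ r s → corner i j a b d r s ≈ M r s
  corner≈ M {i} {j} {a} {b} {d} i≢j supp a≈ b≈ d≈ r s with corner? i j r s
  ... | yes (inj₁ (≡.refl , ≡.refl)) = trans (reflexive (corner-ii i≢j a b d)) a≈
  ... | yes (inj₂ (inj₁ (≡.refl , ≡.refl))) = trans (reflexive (corner-ij i≢j a b d)) b≈
  ... | yes (inj₂ (inj₂ (≡.refl , ≡.refl))) = trans (reflexive (corner-jj i≢j a b d)) d≈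
  ... | no ¬c = trans (≈0-stable (¬c ∘ corner-supported i≢j a b d r s))
                      (sym (≈0-stable (¬c ∘ supp r s)))

  -- The alternatives exclude each other through the entry at (i, j); each becomes one summand of
  -- the count.
  Admissible : Matrix F n n → (i j : Fin n) → Set ℓ
  Admissible M i j =
    (toℕ j ≡ suc (toℕ i) × ¬ M i j ≈ 0#) ⊎
    (M i j ≈ 0# × ¬ M i i ≈ 0# × ¬ M j j ≈ 0#)

  -- Admissible corner matrices have flag-rank 2

  module _ (M : Matrix F n n) {i j : Fin n} (i<j : i Fin.< j)
           (supp : CornerSupported M i j) where
    private
      j≰i : ¬ j Fin.≤ i
      j≰i = ℕₚ.<⇒≱ i<j

    cornerSupported⇒upperTriangular : UpperTriangular F M
    cornerSupported⇒upperTriangular r s s<r =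
      ≈0-stable λ h → ℕₚ.<⇒≱ s<r (Corner⇒≤ i<j (supp r s h))

    -- Block `i` meets the corner only in row `i`, and block `j` only in column `j`, so both have
    -- rank at most 1. Any other block `k` can meet the corner only at (i, j), and then i < k < j.
    admissible⇒flagRank≡2 : Admissible M i j → flagRankℕ M ≡ 2
    admissible⇒flagRank≡2 adm = two-ones⇒sum≡2 (blockRank M) (Finₚ.<⇒≢ i<j)
      (ℕₚ.≤-antisym ρi≤1 (ℕₚ.n≢0⇒n>0 (ρi≢0 adm)))
      (ℕₚ.≤-antisym ρj≤1 (ℕₚ.n≢0⇒n>0 (ρj≢0 adm)))
      λ k k≢i k≢j → blockRank-zero M k λ r s r≤k k≤s →
        ≈0-stable λ h → between k k≢i k≢j r≤k k≤s h (supp r s h) adm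
      where
      ρi≤1 : blockRank M i ℕ.≤ 1
      ρi≤1 = single-row⇒blockRank≤1 M i i λ r s r≤i i≤s r≢i → ≈0-stable λ h →
        case₁ r≤i r≢i (supp r s h)
        where
        case₁ : ∀ {r s} → r Fin.≤ i → r ≢ i → ¬ Corner i j r s
        case₁ r≤i r≢i (inj₁ (r≡i , _))        = r≢i r≡i
        case₁ r≤i r≢i (inj₂ (inj₁ (r≡i , _))) = r≢i r≡i
        case₁ r≤i r≢i (inj₂ (inj₂ (≡.refl , _))) = j≰i r≤i
      ρj≤1 : blockRank M j ℕ.≤ 1
      ρj≤1 = single-column⇒blockRank≤1 M j j λ r s r≤j j≤s s≢j → ≈0-stable λ h →
        case₂ j≤s s≢j (supp r s h)
        where
        case₂ : ∀ {r s} → j Fin.≤ s → s ≢ j → ¬ Corner i j r s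
        case₂ j≤s s≢j (inj₁ (_ , ≡.refl))     = j≰i j≤s
        case₂ j≤s s≢j (inj₂ (inj₁ (_ , s≡j))) = s≢j s≡j
        case₂ j≤s s≢j (inj₂ (inj₂ (_ , s≡j))) = s≢j s≡j
      ρi≢0 : Admissible M i j → blockRank M i ≢ 0
      ρi≢0 (inj₁ (_ , b≉0)) = blockRank-nonzero M i ℕₚ.≤-refl (ℕₚ.<⇒≤ i<j) b≉0
      ρi≢0 (inj₂ (_ , a≉0 , _)) = blockRank-nonzero M i ℕₚ.≤-refl ℕₚ.≤-refl a≉0
      ρj≢0 : Admissible M i j → blockRank M j ≢ 0
      ρj≢0 (inj₁ (_ , b≉0)) = blockRank-nonzero M j (ℕₚ.<⇒≤ i<j) ℕₚ.≤-refl b≉0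
      ρj≢0 (inj₂ (_ , _ , d≉0)) = blockRank-nonzero M j ℕₚ.≤-refl ℕₚ.≤-refl d≉0
      between : ∀ {r s} k → k ≢ i → k ≢ j → r Fin.≤ k → k Fin.≤ s →
                ¬ M r s ≈ 0# → Corner i j r s → ¬ Admissible M i j
      between k k≢i k≢j r≤k k≤s h (inj₁ (≡.refl , ≡.refl)) _ =
        k≢i (Finₚ.≤-antisym k≤s r≤k)
      between k k≢i k≢j r≤k k≤s h (inj₂ (inj₂ (≡.refl , ≡.refl))) _ =
        k≢j (Finₚ.≤-antisym k≤s r≤k)
      -- No index lies strictly between `i` and i + 1.
      between k k≢i k≢j r≤k k≤s h (inj₂ (inj₁ (≡.refl , ≡.refl))) (inj₁ (j≡1+i , _)) =
        ℕₚ.<⇒≱ (Finₚ.≤∧≢⇒< r≤k (k≢i ∘ ≡.sym))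
          (ℕ.s≤s⁻¹ (≡.subst (toℕ k ℕ.<_) j≡1+i (Finₚ.≤∧≢⇒< k≤s k≢j)))
      between k k≢i k≢j r≤k k≤s h (inj₂ (inj₁ (≡.refl , ≡.refl))) (inj₂ (b≈0 , _)) =
        h b≈0

  -- Matrices of flag-rank 2 are admissible

  module _ (M : Matrix F n n) (upper : UpperTriangular F M)
           (flagRank≡2 : flagRankℕ M ≡ 2) where
    private
      ρ : Fin n → ℕ
      ρ = blockRank M

      ≉0⇒≤ : ∀ {r s} → ¬ M r s ≈ 0# → r Fin.≤ s
      ≉0⇒≤ h = ℕₚ.≮⇒≥ λ s<r → h (upper _ _ s<r)

    -- A nonzero entry at (r, s) makes blocks `r` and `s` nonzero, and the sum leaves room only for
    -- `i` and `j`. Triangularity excludes position (j, i).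
    two-nonzero⇒cornerSupported : ∀ {i j} → i Fin.< j → ρ i ≢ 0 → ρ j ≢ 0 →
                                  CornerSupported M i j
    two-nonzero⇒cornerSupported {i} {j} i<j ρi≢0 ρj≢0 r s h
      with r Finₚ.≟ i | r Finₚ.≟ j | s Finₚ.≟ i | s Finₚ.≟ j
    ... | no r≢i  | no r≢j  | _       | _       = contradiction
          (sum≡2⇒others≡0 ρ (Finₚ.<⇒≢ i<j) ρi≢0 ρj≢0 flagRank≡2 r r≢i r≢j)
          (blockRank-nonzero M r ℕₚ.≤-refl (≉0⇒≤ h) h)
    ... | _       | _       | no s≢i  | no s≢j  = contradiction
          (sum≡2⇒others≡0 ρ (Finₚ.<⇒≢ i<j) ρi≢0 ρj≢0 flagRank≡2 s s≢i s≢j)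
          (blockRank-nonzero M s (≉0⇒≤ h) ℕₚ.≤-refl h)
    ... | yes r≡i | _       | yes s≡i | _       = inj₁ (r≡i , s≡i)
    ... | yes r≡i | _       | _       | yes s≡j = inj₂ (inj₁ (r≡i , s≡j))
    ... | _       | yes r≡j | _       | yes s≡j = inj₂ (inj₂ (r≡j , s≡j))
    ... | no _    | yes ≡.refl | yes ≡.refl | no _ = contradiction (upper r s i<j) h

    -- Blocks `r` and `s` already exhaust the sum, so no block strictly between them can be nonzero.
    offDiagonal⇒adjacent : ∀ {r s} → r Fin.< s → ¬ M r s ≈ 0# → toℕ s ≡ suc (toℕ r)
    offDiagonal⇒adjacent {r} {s} r<s h =
      decidable-stable (toℕ s ℕₚ.≟ suc (toℕ r)) λ s≢1+r →
        let 1+r<s = ℕₚ.≤∧≢⇒< r<s (s≢1+r ∘ ≡.sym)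
            -- The offending block is r + 1, which lies strictly before `s` unless s = r + 1.
            k     = fromℕ< (ℕₚ.<-trans 1+r<s (Finₚ.toℕ<n s))
            k≡1+r = Finₚ.toℕ-fromℕ< (ℕₚ.<-trans 1+r<s (Finₚ.toℕ<n s))
            r<k   = ≡.subst (toℕ r ℕ.<_) (≡.sym k≡1+r) (ℕₚ.n<1+n _)
            k<s   = ≡.subst (ℕ._< toℕ s) (≡.sym k≡1+r) 1+r<s
        in blockRank-nonzero M k (ℕₚ.<⇒≤ r<k) (ℕₚ.<⇒≤ k<s) h
             (sum≡2⇒others≡0 ρ (Finₚ.<⇒≢ r<s)
               (blockRank-nonzero M r ℕₚ.≤-refl (ℕₚ.<⇒≤ r<s) h)
               (blockRank-nonzero M s (ℕₚ.<⇒≤ r<s) ℕₚ.≤-refl h)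
               flagRank≡2 k (Finₚ.<⇒≢ r<k ∘ ≡.sym) (Finₚ.<⇒≢ k<s))

    -- A nonzero off-diagonal entry yields two nonzero blocks directly. Without one the matrix is
    -- diagonal, every block has rank at most 1, and the sum 2 must come from two different blocks.
    flagRank≡2⇒admissible :
      ∃₂ λ i j → i Fin.< j × CornerSupported M i j × Admissible M i j
    flagRank≡2⇒admissible
      with any? (λ i → any? λ j → i Finₚ.<? j ×-dec ¬? (_≟_ F (M i j) 0#))
    ... | yes (i , j , i<j , h) = i , j , i<j ,
          two-nonzero⇒cornerSupported i<j
            (blockRank-nonzero M i ℕₚ.≤-refl (ℕₚ.<⇒≤ i<j) h)
            (blockRank-nonzero M j (ℕₚ.<⇒≤ i<j) ℕₚ.≤-refl h) ,
          inj₁ (offDiagonal⇒adjacent i<j h , h)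
    ... | no ¬off =
          let (i , j , i<j , ρi≢0 , ρj≢0) = sum≡2⇒two-nonzero ρ ρ≤1 flagRank≡2
          in i , j , i<j , two-nonzero⇒cornerSupported i<j ρi≢0 ρj≢0 ,
             inj₂ (diagonal (Finₚ.<⇒≢ i<j) , ρ≢0⇒diagonal≉0 ρi≢0 , ρ≢0⇒diagonal≉0 ρj≢0)
      where
      diagonal : ∀ {r s} → r ≢ s → M r s ≈ 0#
      diagonal r≢s = ≈0-stable λ h → ¬off (_ , _ , Finₚ.≤∧≢⇒< (≉0⇒≤ h) r≢s , h)
      ρ≤1 : ∀ i → ρ i ℕ.≤ 1
      -- Inside the block r ≤ i ≤ s, so the only diagonal position there is (i, i).
      ρ≤1 i = single-row⇒blockRank≤1 M i i λ r s r≤i i≤s r≢i →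
        diagonal λ { ≡.refl → r≢i (Finₚ.≤-antisym r≤i i≤s) }
      ρ≢0⇒diagonal≉0 : ∀ {i} → ρ i ≢ 0 → ¬ M i i ≈ 0#
      ρ≢0⇒diagonal≉0 {i} ρ≢0 Mii≈0 = ρ≢0 (blockRank-zero M i Mrs≈0)
        where
        Mrs≈0 : ∀ r s → r Fin.≤ i → i Fin.≤ s → M r s ≈ 0#
        Mrs≈0 r s r≤i i≤s with r Finₚ.≟ s
        ... | no r≢s     = diagonal r≢s
        ... | yes ≡.refl with Finₚ.≤-antisym r≤i i≤s
        ...   | ≡.refl = Mii≈0

-- Counting the codes

-- Grouping the matrices by whether the off-diagonal entry is nonzero gives
-- exactly the two summands of the count.
Code : (m q : ℕ) → Set
Code m q = ((Fin m × (Fin (suc q) × Fin (suc q))) × Fin q) ⊎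
           (Pair (suc m) × (Fin q × Fin q))

-- Here `q` is the number of nonzero field elements and `m` the number of adjacent index pairs. In
-- the first summand the two diagonal entries range over the whole field and the off-diagonal one
-- over nonzero elements; in the second, both diagonal entries are nonzero.
Code↔Fin : ∀ m q → Code m q ↔
  Fin (m ℕ.* suc q ^ 2 ℕ.* q ℕ.+ (suc m C 2) ℕ.* q ^ 2)
Code↔Fin m q = ≡.subst₂
  (λ s t → Code m q ↔ Fin (m ℕ.* s ℕ.* q ℕ.+ (suc m C 2) ℕ.* t))
  -- The product bijections give x * x where the count has a square.
  (x*x≡x^2 (suc q)) (x*x≡x^2 q)
  (↔-sym +↔⊎ ↔-∘
    ((↔-sym *↔× ↔-∘ ((↔-sym *↔× ↔-∘ (↔-refl ×-↔ ↔-sym *↔×)) ×-↔ ↔-refl))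
     ⊎-↔
     (↔-sym *↔× ↔-∘ (Pair↔Fin (suc m) ×-↔ ↔-sym *↔×))))
  where
  x*x≡x^2 : ∀ x → x ℕ.* x ≡ x ^ 2
  x*x≡x^2 x = ≡.cong (x ℕ.*_) (≡.sym (ℕₚ.*-identityʳ x))

-- Enumerating the field and its nonzero elements

module _ {q : ℕ} (F : FiniteField c ℓ (suc q)) where
  open FiniteField F hiding (zero)
  private module Card = Inverse cardinality

  element : Fin (suc q) → Carrier
  element = Card.from

  element-injective : ∀ {x y} → element x ≈ element y → x ≡ y
  element-injective {x} {y} eq = ≡.trans (≡.sym (Card.strictlyInverseˡ x))
    (≡.trans (Card.to-cong eq) (Card.strictlyInverseˡ y))

  element-surjective : ∀ a → element (Card.to a) ≈ a
  element-surjective = Card.strictlyInverseʳ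

  -- Skipping the index of 0 leaves exactly the nonzero elements.
  unit : Fin q → Carrier
  unit x = element (punchIn (Card.to 0#) x)

  unit-injective : ∀ {x y} → unit x ≈ unit y → x ≡ y
  unit-injective = Finₚ.punchIn-injective (Card.to 0#) _ _ ∘ element-injective

  unit≉0 : ∀ x → ¬ unit x ≈ 0#
  unit≉0 x eq = Finₚ.punchInᵢ≢i (Card.to 0#) x
    (element-injective (trans eq (sym (element-surjective 0#))))

  unit-surjective : ∀ {a} → ¬ a ≈ 0# → ∃ λ x → unit x ≈ a
  unit-surjective {a} a≉0 = punchOut 0≢a ,
    trans (reflexive (≡.cong element (Finₚ.punchIn-punchOut 0≢a))) (element-surjective a)
    where
    0≢a : Card.to 0# ≢ Card.to a
    0≢a eq = a≉0 (trans (sym (element-surjective a))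
      (trans (Card.from-cong (≡.sym eq)) (element-surjective 0#)))

  -- From codes to matrices

  lower upper : Code m q → Fin (suc m)
  lower (inj₁ ((i , _) , _)) = inject₁ i
  lower (inj₂ (p , _))       = lo p
  upper (inj₁ ((i , _) , _)) = suc i
  upper (inj₂ (p , _))       = hi p

  lower<upper : (x : Code m q) → lower x Fin.< upper x
  lower<upper (inj₁ ((i , _) , _)) = s≤s (ℕₚ.≤-reflexive (Finₚ.toℕ-inject₁ i))
  lower<upper (inj₂ (p , _))       = lo<hi p

  topLeft topRight bottomRight : Code m q → Carrier
  topLeft     (inj₁ ((_ , x , _) , _)) = element x
  topLeft     (inj₂ (_ , x , _))       = unit x
  topRight    (inj₁ (_ , z))           = unit z
  topRight    (inj₂ _)                 = 0#
  bottomRight (inj₁ ((_ , _ , y) , _)) = element y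
  bottomRight (inj₂ (_ , _ , y))       = unit y

  decode : Code m q → Matrix F (suc m) (suc m)
  decode x = corner F (lower x) (upper x) (topLeft x) (topRight x) (bottomRight x)

  module _ (x : Code m q) where
    private
      l≢u = Finₚ.<⇒≢ (lower<upper x)

    decode-topLeft : decode x (lower x) (lower x) ≈ topLeft x
    decode-topLeft = reflexive (corner-ii F l≢u _ _ _)

    decode-topRight : decode x (lower x) (upper x) ≈ topRight x
    decode-topRight = reflexive (corner-ij F l≢u _ _ _)

    decode-bottomRight : decode x (upper x) (upper x) ≈ bottomRight x
    decode-bottomRight = reflexive (corner-jj F l≢u _ _ _)

    decode-supported : CornerSupported F (decode x) (lower x) (upper x)
    decode-supported = corner-supported F l≢u _ _ _

  decode-admissible : (x : Code m q) → Admissible F (decode x) (lower x) (upper x)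
  decode-admissible x@(inj₁ ((i , _) , z)) = inj₁
    ( ≡.cong suc (≡.sym (Finₚ.toℕ-inject₁ i))
    , λ eq → unit≉0 z (trans (sym (decode-topRight x)) eq))
  decode-admissible x@(inj₂ (_ , a , d)) = inj₂
    ( decode-topRight x
    , (λ eq → unit≉0 a (trans (sym (decode-topLeft x)) eq))
    , (λ eq → unit≉0 d (trans (sym (decode-bottomRight x)) eq)))

  -- Distinct codes give distinct matrices

  private
    infix 4 _≋_
    _≋_ : Matrix F m n → Matrix F m n → Set ℓ
    M ≋ N = ∀ r s → M r s ≈ N r s

    -- Nonzero entries of the first matrix must lie in the corner of the second. A nonzero entry
    -- above the diagonal locates both indices at once; otherwise two nonzero diagonal entries fix
    -- the pair up to order, which `lower<upper` settles.
    corners≡ : (x y : Code m q) → decode x ≋ decode y →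
               lower x ≡ lower y × upper x ≡ upper y
    corners≡ x y eq = go (decode-admissible x)
      where
      supp : ∀ {r s} → ¬ decode x r s ≈ 0# → Corner (lower y) (upper y) r s
      supp h = decode-supported y _ _ (h ∘ trans (eq _ _))
      go : Admissible F (decode x) (lower x) (upper x) →
           lower x ≡ lower y × upper x ≡ upper y
      go (inj₁ (_ , b≉0)) with supp b≉0
      ... | inj₁ (p , r) = contradiction (≡.trans p (≡.sym r)) (Finₚ.<⇒≢ (lower<upper x))
      ... | inj₂ (inj₁ p) = p
      ... | inj₂ (inj₂ (p , r)) =
            contradiction (≡.trans p (≡.sym r)) (Finₚ.<⇒≢ (lower<upper x))
      go (inj₂ (_ , a≉0 , d≉0)) = match (diagonal (supp a≉0)) (diagonal (supp d≉0))
        where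
        diagonal : ∀ {r} → Corner (lower y) (upper y) r r → r ≡ lower y ⊎ r ≡ upper y
        diagonal (inj₁ (p , _))        = inj₁ p
        diagonal (inj₂ (inj₁ (p , _))) = inj₁ p
        diagonal (inj₂ (inj₂ (p , _))) = inj₂ p
        match : lower x ≡ lower y ⊎ lower x ≡ upper y →
                upper x ≡ lower y ⊎ upper x ≡ upper y →
                lower x ≡ lower y × upper x ≡ upper y
        match (inj₁ p) (inj₂ r) = p , r
        match (inj₁ p) (inj₁ r) =
          contradiction (≡.trans p (≡.sym r)) (Finₚ.<⇒≢ (lower<upper x))
        match (inj₂ p) (inj₂ r) =
          contradiction (≡.trans p (≡.sym r)) (Finₚ.<⇒≢ (lower<upper x))
        -- Swapped indices would contradict the order of the second pair.
        match (inj₂ p) (inj₁ r) = contradiction (lower<upper y)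
          (ℕₚ.<⇒≯ (≡.subst₂ Fin._<_ p r (lower<upper x)))

    entries≈ : (x y : Code m q) → decode x ≋ decode y →
               lower x ≡ lower y → upper x ≡ upper y →
               topLeft x ≈ topLeft y × topRight x ≈ topRight y × bottomRight x ≈ bottomRight y
    entries≈ x y eq l u =
      transport l l (decode-topLeft x) (decode-topLeft y) ,
      transport l u (decode-topRight x) (decode-topRight y) ,
      transport u u (decode-bottomRight x) (decode-bottomRight y)
      where
      transport : ∀ {r s r′ s′ a b} → r ≡ r′ → s ≡ s′ →
                  decode x r s ≈ a → decode y r′ s′ ≈ b → a ≈ b
      transport {r} {s} ≡.refl ≡.refl p p′ = trans (sym p) (trans (eq r s) p′)

  decode-injective : (x y : Code m q) → decode x ≋ decode y → x ≡ y
  decode-injective x y eq =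
    let (l , u) = corners≡ x y eq in go x y l u (entries≈ x y eq l u)
    where
    go : (x y : Code m q) → lower x ≡ lower y → upper x ≡ upper y →
         topLeft x ≈ topLeft y × topRight x ≈ topRight y × bottomRight x ≈ bottomRight y →
         x ≡ y
    go (inj₁ _) (inj₁ _) _ u (a , b , d) = ≡.cong inj₁ (≡.cong₂ _,_
      (≡.cong₂ _,_ (Finₚ.suc-injective u)
        (≡.cong₂ _,_ (element-injective a) (element-injective d)))
      (unit-injective b))
    go (inj₂ (p , _)) (inj₂ (p′ , _)) l u (a , _ , d) = ≡.cong inj₂
      (≡.cong₂ _,_ (pair-injective p p′ l u)
        (≡.cong₂ _,_ (unit-injective a) (unit-injective d)))
    -- Codes of different kinds differ in the top right entry, which is nonzero for one and 0 for
    -- the other.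
    go (inj₁ (_ , z)) (inj₂ _) _ _ (_ , b , _) = contradiction b (unit≉0 z)
    go (inj₂ _) (inj₁ (_ , z)) _ _ (_ , b , _) = contradiction (sym b) (unit≉0 z)

  -- From matrices back to codes

  decode-surjective : (M : Matrix F (suc m) (suc m)) {i j : Fin (suc m)} →
    i Fin.< j → CornerSupported F M i j → Admissible F M i j →
    ∃ λ x → decode x ≋ M
  decode-surjective M {i} {suc j} i<j supp (inj₁ (j≡1+i , b≉0))
    -- With the upper index written as `suc j`, adjacency forces `i` to be `inject₁ j`, the form
    -- that codes use.
    with ≡.refl ← Finₚ.toℕ-injective
           (≡.trans (Finₚ.toℕ-inject₁ j) (ℕₚ.suc-injective j≡1+i)) =
    let (z , z≈) = unit-surjective b≉0
    in inj₁ ((j , Card.to (M i i) , Card.to (M (suc j) (suc j))) , z) ,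
       corner≈ F M (Finₚ.<⇒≢ i<j) supp (element-surjective _) z≈ (element-surjective _)
  decode-surjective M {i} {j} i<j supp (inj₂ (b≈0 , a≉0 , d≉0))
    with pair i j i<j | unit-surjective a≉0 | unit-surjective d≉0
  ... | p , ≡.refl , ≡.refl | x , x≈ | y , y≈ =
    inj₂ (p , x , y) , corner≈ F M (Finₚ.<⇒≢ i<j) supp x≈ (sym b≈0) y≈

  sphere : ℕ → Setoid _ _
  sphere m = flagRankSphere F (suc m) 2

  -- The code chosen for a matrix is characterised by decoding to it entrywise. Injectivity of
  -- `decode` therefore makes the choice respect equality and gives the inverse law on codes; the
  -- law on matrices is the characterisation itself.
  sphere↔Code : ∀ m → Inverse (sphere m) (≡.setoid (Code m q))
  sphere↔Code m = record
    { to        = λ A → proj₁ (encode A)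
    ; from      = fromCode
    ; to-cong   = λ {A} {B} A≈B → decode-injective _ _ λ r s →
        trans (proj₂ (encode A) r s) (trans (A≈B r s) (sym (proj₂ (encode B) r s)))
    ; from-cong = λ { {x} ≡.refl → Setoid.refl (sphere m) {fromCode x} }
    ; inverse   =
        (λ {x} {A} A≈x → decode-injective _ _ λ r s →
          trans (proj₂ (encode A) r s) (A≈x r s))
      , (λ { {A} ≡.refl → proj₂ (encode A) })
    }
    where
    encode : (A : Setoid.Carrier (sphere m)) → ∃ λ x → decode x ≋ proj₁ (proj₁ A)
    encode ((M , upper) , fr≡2) =
      let (i , j , i<j , supp , adm) = flagRank≡2⇒admissible F M upper fr≡2
      in decode-surjective M i<j supp adm
    fromCode : Code m q → Setoid.Carrier (sphere m)
    fromCode x =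
      (decode x , cornerSupported⇒upperTriangular F _ (lower<upper x) (decode-supported x)) ,
      admissible⇒flagRank≡2 F _ (lower<upper x) (decode-supported x) (decode-admissible x)

open import Data.Nat.Base using (_+_; _*_; _≤_)

proposition3p2 : {c ℓ : Level} (q : ℕ) → IsPrimePower q →
    (F : FiniteField c ℓ q) →
    (n : ℕ) → 2 ≤ n →
    HasCardinality (flagRankSphere F n 2)
    ((n ∸ 1) * q ^ 2 * (q ∸ 1) + (n C 2) * (q ∸ 1) ^ 2)
-- The field contains 0, so it is not in bijection with an empty set.
proposition3p2 zero    _ F with () ← Inverse.to (FiniteField.cardinality F) (FiniteField.0# F)
-- With n = m + 1 and a field of `suc q` elements, the truncated subtractions in the formula compute
-- to `m` and `q`.
proposition3p2 (suc q) _ F (suc m) _ = inverse-∘ (sphere↔Code F m) (Code↔Fin m q)
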